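{- Let $n \ge 1$ and let $\mathcal{P}$ be a distinct pair-sum (dps) polytope in $\mathbb{R}^n$. Then $N(\mathcal{P}) \le 2^n$, where $N(\mathcal{P}) = |\mathcal{P} \cap \mathbb{Z}^n|$.
   Context: A lattice polytope $\mathcal{P}$ in $\mathbb{R}^n$ is the convex hull of a finite subset of $\mathbb{Z}^n$ (it is not required to be full-dimensional). Write $\mathcal{L}(\mathcal{P}) := \mathcal{P} \cap \mathbb{Z}^n = \{v_1,\dots,v_N\}$, where $N = N(\mathcal{P}) := |\mathcal{L}(\mathcal{P})|$. The lattice polytope $\mathcal{P}$ is called a distinct pair-sum (dps) polytope if the $N + \binom{N}{2}$ sums $2v_1,\dots,2v_N$ and $v_i+v_j$ ($1 \le i<j\le N$) are all distinct, i.e. $v_i + v_j = v_k + v_\ell$ implies $\{i,j\}=\{k,\ell\}$ as multisets. -}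

module Defs where

open import Data.Nat.Base as ℕ using (ℕ)
import Data.Nat.Properties as ℕ
open import Data.Integer.Base as ℤ using (ℤ)
open import Data.Rational.Base as ℚ using (ℚ; 0ℚ; 1ℚ; ½; ∣_∣)
import Data.Rational.Properties as ℚ
import Data.Rational.Solver as ℚ
open import Data.Fin.Base using (Fin)
open import Data.Fin.Properties using () renaming (≡-setoid to Fin-setoid)
open import Data.List.Base as List using (List; []; _∷_)
open import Data.List.Relation.Binary.Permutation.Propositional using (_↭_)
open import Data.Product.Base using (Σ; ∃; _×_; _,_; proj₁)
open import Data.Vec.Base as Vec using (Vec)
open import Data.Vec.Functional using (Vector; foldr)
open import Function.Bundles using (Bijection)
open import Level using (0ℓ)
open import Relation.Binary.Bundles using (Setoid)
import Relation.Binary.Construct.On as On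
open import Relation.Binary.PropositionalEquality
  using (_≡_; refl; sym; cong; subst; setoid)
open import Relation.Unary using (Pred; _≐_)

-- Real numbers: Cauchy sequences of rationals, with equality and order taken
-- in the limit.

Eventually : (ℕ → Set) → Set
Eventually P = ∃ λ N → ∀ n → N ℕ.≤ n → P n

IsCauchy : (ℕ → ℚ) → Set
IsCauchy x = ∀ ε → 0ℚ ℚ.< ε →
  ∃ λ N → ∀ m n → N ℕ.≤ m → N ℕ.≤ n → ∣ x m ℚ.- x n ∣ ℚ.< ε

record ℝ : Set where
  constructor mkℝ
  field
    seq    : ℕ → ℚ
    cauchy : IsCauchy seq

open ℝ public

infix 4 _≈_ _≤_

_≈_ : ℝ → ℝ → Set
x ≈ y = ∀ ε → 0ℚ ℚ.< ε → Eventually λ n → ∣ seq x n ℚ.- seq y n ∣ ℚ.< ε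

_≤_ : ℝ → ℝ → Set
x ≤ y = ∀ ε → 0ℚ ℚ.< ε → Eventually λ n → seq x n ℚ.< seq y n ℚ.+ ε

fromℚ : ℚ → ℝ
fromℚ q = mkℝ (λ _ → q) λ ε 0<ε →
  0 , λ _ _ _ _ → subst (ℚ._< ε) (sym (cong ∣_∣ (ℚ.+-inverseʳ q))) 0<ε

fromℤ : ℤ → ℝ
fromℤ z = fromℚ (z ℚ./ 1)

0ℝ 1ℝ : ℝ
0ℝ = fromℚ 0ℚ
1ℝ = fromℚ 1ℚ

private
  open ℚ.+-*-Solver using (solve; _:=_; _:+_; _:*_; _:-_)
  open ℚ.≤-Reasoning

  abstract
    +-minus-+ : ∀ a b c d → (a ℚ.+ b) ℚ.- (c ℚ.+ d) ≡ (a ℚ.- c) ℚ.+ (b ℚ.- d)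
    +-minus-+ = solve 4
      (λ a b c d → (a :+ b) :- (c :+ d) := (a :- c) :+ (b :- d)) refl

    *-minus-* : ∀ a b c d → a ℚ.* b ℚ.- c ℚ.* d ≡ a ℚ.* (b ℚ.- d) ℚ.+ d ℚ.* (a ℚ.- c)
    *-minus-* = solve 4
      (λ a b c d → a :* b :- c :* d := a :* (b :- d) :+ d :* (a :- c)) refl

    minus-cancel : ∀ a b → a ≡ b ℚ.+ (a ℚ.- b)
    minus-cancel = solve 2 (λ a b → a := b :+ (a :- b)) refl

    half-pos : ∀ ε → 0ℚ ℚ.< ε → 0ℚ ℚ.< ½ ℚ.* ε
    half-pos ε 0<ε = subst (ℚ._< ½ ℚ.* ε) (ℚ.*-zeroʳ ½) (ℚ.*-monoʳ-<-pos ½ 0<ε)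

    +-cauchy : ∀ {x y} → IsCauchy x → IsCauchy y → IsCauchy (λ n → x n ℚ.+ y n)
    +-cauchy {x} {y} cx cy ε 0<ε
      with Nx , px ← cx (½ ℚ.* ε) (half-pos ε 0<ε)
         | Ny , py ← cy (½ ℚ.* ε) (half-pos ε 0<ε)
      = Nx ℕ.⊔ Ny , λ m n N≤m N≤n → begin-strict
        ∣ (x m ℚ.+ y m) ℚ.- (x n ℚ.+ y n) ∣
          ≡⟨ cong ∣_∣ (+-minus-+ (x m) (y m) (x n) (y n)) ⟩
        ∣ (x m ℚ.- x n) ℚ.+ (y m ℚ.- y n) ∣
          ≤⟨ ℚ.∣p+q∣≤∣p∣+∣q∣ (x m ℚ.- x n) (y m ℚ.- y n) ⟩
        ∣ x m ℚ.- x n ∣ ℚ.+ ∣ y m ℚ.- y n ∣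
          <⟨ ℚ.+-mono-< (px m n (ℕ.m⊔n≤o⇒m≤o Nx Ny N≤m) (ℕ.m⊔n≤o⇒m≤o Nx Ny N≤n))
                        (py m n (ℕ.m⊔n≤o⇒n≤o Nx Ny N≤m) (ℕ.m⊔n≤o⇒n≤o Nx Ny N≤n)) ⟩
        ½ ℚ.* ε ℚ.+ ½ ℚ.* ε
          ≡⟨ ℚ.*-distribʳ-+ ε ½ ½ ⟨
        1ℚ ℚ.* ε
          ≡⟨ ℚ.*-identityˡ ε ⟩
        ε ∎

    bounded : ∀ {x} → IsCauchy x →
      ∃ λ B → 0ℚ ℚ.< B × Eventually λ n → ∣ x n ∣ ℚ.≤ B
    bounded {x} cx with N , p ← cx 1ℚ (ℚ.positive⁻¹ 1ℚ)
      = ∣ x N ∣ ℚ.+ 1ℚ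
      , ℚ.+-mono-≤-< (ℚ.0≤∣p∣ (x N)) (ℚ.positive⁻¹ 1ℚ)
      , N , λ n N≤n → begin
        ∣ x n ∣
          ≡⟨ cong ∣_∣ (minus-cancel (x n) (x N)) ⟩
        ∣ x N ℚ.+ (x n ℚ.- x N) ∣
          ≤⟨ ℚ.∣p+q∣≤∣p∣+∣q∣ (x N) (x n ℚ.- x N) ⟩
        ∣ x N ∣ ℚ.+ ∣ x n ℚ.- x N ∣
          <⟨ ℚ.+-monoʳ-< ∣ x N ∣ (p n N N≤n ℕ.≤-refl) ⟩
        ∣ x N ∣ ℚ.+ 1ℚ ∎

    *-bound : ∀ {A δ} a d → 0ℚ ℚ.< A → ∣ a ∣ ℚ.≤ A → ∣ d ∣ ℚ.< δ →
              ∣ a ℚ.* d ∣ ℚ.< A ℚ.* δ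
    *-bound {A} {δ} a d 0<A a≤A d<δ = begin-strict
      ∣ a ℚ.* d ∣       ≡⟨ ℚ.∣p*q∣≡∣p∣*∣q∣ a d ⟩
      ∣ a ∣ ℚ.* ∣ d ∣   ≤⟨ ℚ.*-monoʳ-≤-nonNeg ∣ d ∣ {{ℚ.∣-∣-nonNeg d}} a≤A ⟩
      A ℚ.* ∣ d ∣       <⟨ ℚ.*-monoʳ-<-pos A {{ℚ.positive 0<A}} d<δ ⟩
      A ℚ.* δ           ∎

    divide : ∀ C ε → 0ℚ ℚ.< C → 0ℚ ℚ.< ε → ∃ λ δ → 0ℚ ℚ.< δ × C ℚ.* δ ≡ ε
    divide C ε 0<C 0<ε = C⁻¹ ℚ.* ε , 0<δ , Cδ≡ε
      where
      instance
        C-pos : ℚ.Positive C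
        C-pos = ℚ.positive 0<C

        C-nonZero : ℚ.NonZero C
        C-nonZero = ℚ.pos⇒nonZero C

      C⁻¹ : ℚ
      C⁻¹ = ℚ.1/ C

      0<δ : 0ℚ ℚ.< C⁻¹ ℚ.* ε
      0<δ = subst (ℚ._< C⁻¹ ℚ.* ε) (ℚ.*-zeroʳ C⁻¹)
        (ℚ.*-monoʳ-<-pos C⁻¹ {{ℚ.1/pos⇒pos C}} 0<ε)

      Cδ≡ε : C ℚ.* (C⁻¹ ℚ.* ε) ≡ ε
      Cδ≡ε = begin-equality
        C ℚ.* (C⁻¹ ℚ.* ε)    ≡⟨ ℚ.*-assoc C C⁻¹ ε ⟨
        (C ℚ.* C⁻¹) ℚ.* ε    ≡⟨ cong (ℚ._* ε) (ℚ.*-inverseʳ C) ⟩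
        1ℚ ℚ.* ε             ≡⟨ ℚ.*-identityˡ ε ⟩
        ε                    ∎

    *-diff-bound : ∀ A B δ ε a b c d → 0ℚ ℚ.< A → 0ℚ ℚ.< B → (A ℚ.+ B) ℚ.* δ ≡ ε →
      ∣ a ∣ ℚ.≤ A → ∣ d ∣ ℚ.≤ B → ∣ a ℚ.- c ∣ ℚ.< δ → ∣ b ℚ.- d ∣ ℚ.< δ →
      ∣ a ℚ.* b ℚ.- c ℚ.* d ∣ ℚ.< ε
    *-diff-bound A B δ ε a b c d 0<A 0<B Cδ≡ε a≤A d≤B a-c<δ b-d<δ = begin-strict
      ∣ a ℚ.* b ℚ.- c ℚ.* d ∣
        ≡⟨ cong ∣_∣ (*-minus-* a b c d) ⟩
      ∣ a ℚ.* (b ℚ.- d) ℚ.+ d ℚ.* (a ℚ.- c) ∣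
        ≤⟨ ℚ.∣p+q∣≤∣p∣+∣q∣ (a ℚ.* (b ℚ.- d)) (d ℚ.* (a ℚ.- c)) ⟩
      ∣ a ℚ.* (b ℚ.- d) ∣ ℚ.+ ∣ d ℚ.* (a ℚ.- c) ∣
        <⟨ ℚ.+-mono-< (*-bound a (b ℚ.- d) 0<A a≤A b-d<δ)
                      (*-bound d (a ℚ.- c) 0<B d≤B a-c<δ) ⟩
      A ℚ.* δ ℚ.+ B ℚ.* δ
        ≡⟨ ℚ.*-distribʳ-+ δ A B ⟨
      (A ℚ.+ B) ℚ.* δ
        ≡⟨ Cδ≡ε ⟩
      ε ∎

    0<A+B : ∀ A B → 0ℚ ℚ.< A → 0ℚ ℚ.< B → 0ℚ ℚ.< A ℚ.+ B
    0<A+B A B 0<A 0<B = ℚ.+-mono-< 0<A 0<B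

    *-cauchy : ∀ {x y} → IsCauchy x → IsCauchy y → IsCauchy (λ n → x n ℚ.* y n)
    *-cauchy {x} {y} cx cy ε 0<ε =
      let A , 0<A , Na , pa = bounded {x} cx
          B , 0<B , Nb , pb = bounded {y} cy
          δ , 0<δ , Cδ≡ε = divide (A ℚ.+ B) ε (0<A+B A B 0<A 0<B) 0<ε
          Nx , px = cx δ 0<δ
          Ny , py = cy δ 0<δ
      in (Na ℕ.⊔ Nb) ℕ.⊔ (Nx ℕ.⊔ Ny) , λ m n N≤m N≤n →
        let ab≤m = ℕ.m⊔n≤o⇒m≤o (Na ℕ.⊔ Nb) (Nx ℕ.⊔ Ny) N≤m
            xy≤m = ℕ.m⊔n≤o⇒n≤o (Na ℕ.⊔ Nb) (Nx ℕ.⊔ Ny) N≤m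
            ab≤n = ℕ.m⊔n≤o⇒m≤o (Na ℕ.⊔ Nb) (Nx ℕ.⊔ Ny) N≤n
            xy≤n = ℕ.m⊔n≤o⇒n≤o (Na ℕ.⊔ Nb) (Nx ℕ.⊔ Ny) N≤n
        in *-diff-bound A B δ ε (x m) (y m) (x n) (y n) 0<A 0<B Cδ≡ε
            (pa m (ℕ.m⊔n≤o⇒m≤o Na Nb ab≤m))
            (pb n (ℕ.m⊔n≤o⇒n≤o Na Nb ab≤n))
            (px m n (ℕ.m⊔n≤o⇒m≤o Nx Ny xy≤m) (ℕ.m⊔n≤o⇒m≤o Nx Ny xy≤n))
            (py m n (ℕ.m⊔n≤o⇒n≤o Nx Ny xy≤m) (ℕ.m⊔n≤o⇒n≤o Nx Ny xy≤n))

infixl 6 _+_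
infixl 7 _*_

_+_ : ℝ → ℝ → ℝ
x + y = mkℝ (λ n → seq x n ℚ.+ seq y n) (+-cauchy {seq x} {seq y} (cauchy x) (cauchy y))

_*_ : ℝ → ℝ → ℝ
x * y = mkℝ (λ n → seq x n ℚ.* seq y n) (*-cauchy {seq x} {seq y} (cauchy x) (cauchy y))

∑ : ∀ {k} → Vector ℝ k → ℝ
∑ = foldr _+_ 0ℝ

ℝ^_ : ℕ → Set
ℝ^ n = Vector ℝ n

-- Vec rather than Vector, so that ≡ is equality of integer points.
ℤ^_ : ℕ → Set
ℤ^ n = Vec ℤ n

_⊕_ : ∀ {n} → ℤ^ n → ℤ^ n → ℤ^ n
_⊕_ = Vec.zipWith ℤ._+_

ι : ∀ {n} → ℤ^ n → ℝ^ n
ι v c = fromℤ (Vec.lookup v c)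

conv : ∀ {n} → List (ℝ^ n) → Pred (ℝ^ n) 0ℓ
conv S x = Σ (Vector ℝ (List.length S)) λ t →
  (∀ i → 0ℝ ≤ t i) ×
  ∑ t ≈ 1ℝ ×
  (∀ c → x c ≈ ∑ (λ i → t i * List.lookup S i c))

IsLatticePolytope : ∀ {n} → Pred (ℝ^ n) 0ℓ → Set
IsLatticePolytope {n} P = Σ (List (ℤ^ n)) λ S → P ≐ conv (List.map ι S)

𝓛 : ∀ {n} → Pred (ℝ^ n) 0ℓ → Pred (ℤ^ n) 0ℓ
𝓛 P v = P (ι v)

-- Membership proofs are ignored: two elements are equal when the underlying
-- points are.
subsetSetoid : {A : Set} → Pred A 0ℓ → Setoid 0ℓ 0ℓ
subsetSetoid {A} Q = On.setoid {B = Σ A Q} (setoid A) proj₁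

HasCardinality : {A : Set} → Pred A 0ℓ → ℕ → Set
HasCardinality Q N = Bijection (Fin-setoid N) (subsetSetoid Q)

-- Two-element lists up to permutation encode the multisets {u , v} and {w , z}.
DistinctPairSums : ∀ {n} → Pred (ℝ^ n) 0ℓ → Set
DistinctPairSums P = ∀ u v w z → 𝓛 P u → 𝓛 P v → 𝓛 P w → 𝓛 P z →
  u ⊕ v ≡ w ⊕ z → (u ∷ v ∷ []) ↭ (w ∷ z ∷ [])

record IsDPSPolytope {n} (P : Pred (ℝ^ n) 0ℓ) : Set where
  field
    isLatticePolytope : IsLatticePolytope P
    distinctPairSums  : DistinctPairSums P

{-# OPTIONS --safe #-}

-- If N > 2^n, two distinct lattice points u and v of P agree modulo 2 in every
-- coordinate, so their midpoint m is integral, and it lies in P by convexity.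
-- Then u + v = m + m is a coincidence of pair sums, which forces u = m = v.

module Submission where

open import Defs using (ℝ^_; 𝓛; HasCardinality; IsDPSPolytope)
import Defs as D
open import Defs using
  (ℝ; seq; fromℚ; 0ℝ; 1ℝ; ∑; ℤ^_; _⊕_; ι; conv; Eventually)
open import Data.Nat.Base using (ℕ; _≤_; _^_; _⊔_)
open import Level using (0ℓ)
open import Relation.Unary using (Pred)

open import Data.Fin.Base using (Fin; zero; suc; fromℕ<; funToFin; finToFun)
open import Data.Fin.Properties using (fromℕ<-injective; finToFun-funToFin; pigeonhole; <⇒≢)
open import Data.Integer.Base as ℤ using (ℤ; +_)
open import Data.Integer.DivMod using (_%ℕ_; _/ℕ_; n%ℕd<d; a≡a%ℕn+[a/ℕn]*n)
import Data.Integer.Properties as ℤ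
import Data.Integer.Solver as ℤ
open import Data.List.Base using (List; []; _∷_; lookup; map)
open import Data.List.Membership.Propositional using (_∈_)
open import Data.List.Relation.Binary.Permutation.Propositional using (_↭_)
open import Data.List.Relation.Binary.Permutation.Propositional.Properties using (∈-resp-↭)
open import Data.List.Relation.Unary.Any using (here; there)
open import Data.Nat.Properties using (≮⇒≥; m⊔n≤o⇒m≤o; m⊔n≤o⇒n≤o)
open import Data.Product.Base using (∃; _,_; proj₁; proj₂)
open import Data.Rational.Base as ℚ using (½; ∣_∣)
import Data.Rational.Properties as ℚ
import Data.Rational.Solver as ℚ
open import Data.Rational.Unnormalised.Base using (mkℚᵘ; *≡*)
import Data.Rational.Unnormalised.Base as ℚᵘ using (_+_)
import Data.Rational.Unnormalised.Properties as ℚᵘ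
open import Data.Vec.Base as Vec using ([]; _∷_)
open import Data.Vec.Functional using (Vector)
open import Data.Vec.Properties using (lookup-zipWith)
open import Function.Base using (_∘_)
open import Function.Bundles using (Bijection)
open import Relation.Binary.PropositionalEquality
  using (_≡_; refl; sym; trans; cong; cong₂; subst₂; module ≡-Reasoning)

-- `seq (mid x y) n` unfolds to `½ ℚ.* (seq x n ℚ.+ seq y n)`, so facts about midpoints reduce to
-- rational ones term by term.
mid : ℝ → ℝ → ℝ
mid x y = fromℚ ½ D.* (x D.+ y)

private
  open ℚ.+-*-Solver using (solve; _:=_; _:+_; _:*_; _:-_)

  abstract
    -- In this and the next three identities the factor is a variable `h`, later set to `½`; the
    -- solver then sees no rational constants.
    scale-minus : ∀ h a b c d →
      h ℚ.* (a ℚ.+ b) ℚ.- h ℚ.* (c ℚ.+ d) ≡ h ℚ.* (a ℚ.- c) ℚ.+ h ℚ.* (b ℚ.- d)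
    scale-minus = solve 5 (λ h a b c d →
      h :* (a :+ b) :- h :* (c :+ d) := h :* (a :- c) :+ h :* (b :- d)) refl

    scale-shift : ∀ h a b ε →
      h ℚ.* (a ℚ.+ ε) ℚ.+ h ℚ.* (b ℚ.+ ε) ≡ h ℚ.* (a ℚ.+ b) ℚ.+ (h ℚ.* ε ℚ.+ h ℚ.* ε)
    scale-shift = solve 4 (λ h a b ε →
      h :* (a :+ ε) :+ h :* (b :+ ε) := h :* (a :+ b) :+ (h :* ε :+ h :* ε)) refl

    scale-interchange : ∀ h a b c d →
      h ℚ.* (a ℚ.+ b) ℚ.+ h ℚ.* (c ℚ.+ d) ≡ h ℚ.* ((a ℚ.+ c) ℚ.+ (b ℚ.+ d))
    scale-interchange = solve 5 (λ h a b c d →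
      h :* (a :+ b) :+ h :* (c :+ d) := h :* ((a :+ c) :+ (b :+ d))) refl

    scale-distribʳ : ∀ h a b s →
      (h ℚ.* (a ℚ.+ b)) ℚ.* s ≡ h ℚ.* (a ℚ.* s ℚ.+ b ℚ.* s)
    scale-distribʳ = solve 4 (λ h a b s →
      (h :* (a :+ b)) :* s := h :* (a :* s :+ b :* s)) refl

    ½-double : ∀ p → ½ ℚ.* p ℚ.+ ½ ℚ.* p ≡ p
    ½-double p = trans (sym (ℚ.*-distribʳ-+ p ½ ½)) (ℚ.*-identityˡ p)

    -- Each error is halved before the two are added, so the same `ε` serves in hypotheses and
    -- conclusion.
    ∣mid-mid∣< : ∀ {a b c d ε} → ∣ a ℚ.- c ∣ ℚ.< ε → ∣ b ℚ.- d ∣ ℚ.< ε →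
      ∣ ½ ℚ.* (a ℚ.+ b) ℚ.- ½ ℚ.* (c ℚ.+ d) ∣ ℚ.< ε
    ∣mid-mid∣< {a} {b} {c} {d} {ε} a-c<ε b-d<ε = begin-strict
      ∣ ½ ℚ.* (a ℚ.+ b) ℚ.- ½ ℚ.* (c ℚ.+ d) ∣
        ≡⟨ cong ∣_∣ (scale-minus ½ a b c d) ⟩
      ∣ ½ ℚ.* (a ℚ.- c) ℚ.+ ½ ℚ.* (b ℚ.- d) ∣
        ≤⟨ ℚ.∣p+q∣≤∣p∣+∣q∣ (½ ℚ.* (a ℚ.- c)) (½ ℚ.* (b ℚ.- d)) ⟩
      ∣ ½ ℚ.* (a ℚ.- c) ∣ ℚ.+ ∣ ½ ℚ.* (b ℚ.- d) ∣
        ≡⟨ cong₂ ℚ._+_ (ℚ.∣p*q∣≡∣p∣*∣q∣ ½ (a ℚ.- c)) (ℚ.∣p*q∣≡∣p∣*∣q∣ ½ (b ℚ.- d)) ⟩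
      ½ ℚ.* ∣ a ℚ.- c ∣ ℚ.+ ½ ℚ.* ∣ b ℚ.- d ∣
        <⟨ ℚ.+-mono-< (ℚ.*-monoʳ-<-pos ½ a-c<ε) (ℚ.*-monoʳ-<-pos ½ b-d<ε) ⟩
      ½ ℚ.* ε ℚ.+ ½ ℚ.* ε
        ≡⟨ ½-double ε ⟩
      ε ∎
      where open ℚ.≤-Reasoning

    mid<mid+ : ∀ {a b c d ε} → a ℚ.< c ℚ.+ ε → b ℚ.< d ℚ.+ ε →
      ½ ℚ.* (a ℚ.+ b) ℚ.< ½ ℚ.* (c ℚ.+ d) ℚ.+ ε
    mid<mid+ {a} {b} {c} {d} {ε} a<c+ε b<d+ε = begin-strict
      ½ ℚ.* (a ℚ.+ b)
        ≡⟨ ℚ.*-distribˡ-+ ½ a b ⟩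
      ½ ℚ.* a ℚ.+ ½ ℚ.* b
        <⟨ ℚ.+-mono-< (ℚ.*-monoʳ-<-pos ½ a<c+ε) (ℚ.*-monoʳ-<-pos ½ b<d+ε) ⟩
      ½ ℚ.* (c ℚ.+ ε) ℚ.+ ½ ℚ.* (d ℚ.+ ε)
        ≡⟨ scale-shift ½ c d ε ⟩
      ½ ℚ.* (c ℚ.+ d) ℚ.+ (½ ℚ.* ε ℚ.+ ½ ℚ.* ε)
        ≡⟨ cong (½ ℚ.* (c ℚ.+ d) ℚ.+_) (½-double ε) ⟩
      ½ ℚ.* (c ℚ.+ d) ℚ.+ ε ∎
      where open ℚ.≤-Reasoning

Eventually-zip : ∀ {P Q R : ℕ → Set} → (∀ n → P n → Q n → R n) →
  Eventually P → Eventually Q → Eventually R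
Eventually-zip f (M , p) (N , q) = M ⊔ N , λ n M⊔N≤n →
  f n (p n (m⊔n≤o⇒m≤o M N M⊔N≤n)) (q n (m⊔n≤o⇒n≤o M N M⊔N≤n))

mid-cong : ∀ x y x′ y′ → x D.≈ x′ → y D.≈ y′ → mid x y D.≈ mid x′ y′
mid-cong x y x′ y′ x≈x′ y≈y′ ε 0<ε =
  Eventually-zip (λ n → ∣mid-mid∣< {seq x n} {seq y n} {seq x′ n} {seq y′ n})
    (x≈x′ ε 0<ε) (y≈y′ ε 0<ε)

mid-mono-≤ : ∀ x y x′ y′ → x D.≤ x′ → y D.≤ y′ → mid x y D.≤ mid x′ y′
mid-mono-≤ x y x′ y′ x≤x′ y≤y′ ε 0<ε =
  Eventually-zip (λ n → mid<mid+ {seq x n} {seq y n} {seq x′ n} {seq y′ n})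
    (x≤x′ ε 0<ε) (y≤y′ ε 0<ε)

-- Reals with equal sequences may still carry different Cauchy proofs, so rewriting along `≡` in `ℝ`
-- is avoided; `≈` inspects only `seq`.
≈-respects-seq : ∀ x y x′ y′ →
  (∀ n → seq x n ≡ seq x′ n) → (∀ n → seq y n ≡ seq y′ n) → x D.≈ y → x′ D.≈ y′
≈-respects-seq x y x′ y′ x≗x′ y≗y′ x≈y ε 0<ε with N , p ← x≈y ε 0<ε =
  N , λ n N≤n → subst₂ (λ a b → ∣ a ℚ.- b ∣ ℚ.< ε) (x≗x′ n) (y≗y′ n) (p n N≤n)

-- `h` is kept separate because weighted coordinates become midpoints only after applying
-- distributivity.
seq-∑-mid : ∀ {k} (f g h : Vector ℝ k) n →
  (∀ i → seq (h i) n ≡ seq (mid (f i) (g i)) n) →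
  seq (∑ h) n ≡ seq (mid (∑ f) (∑ g)) n
seq-∑-mid {ℕ.zero}  f g h n h≡mid = refl
seq-∑-mid {ℕ.suc k} f g h n h≡mid = trans
  (cong₂ ℚ._+_ (h≡mid zero) (seq-∑-mid (f ∘ suc) (g ∘ suc) (h ∘ suc) n (h≡mid ∘ suc)))
  (scale-interchange ½ (seq (f zero) n) (seq (g zero) n)
    (seq (∑ (f ∘ suc)) n) (seq (∑ (g ∘ suc)) n))

-- Averaging the weights of two convex combinations gives weights for the midpoint. The point `z` is
-- known only through its sequences, so that it can be an embedded integer point.
conv-mid : ∀ {n} (S : List (ℝ^ n)) (x y z : ℝ^ n) →
  (∀ c k → seq (mid (x c) (y c)) k ≡ seq (z c) k) →
  conv S x → conv S y → conv S z
conv-mid S x y z mid≗z (s , 0≤s , ∑s≈1 , x≈) (t , 0≤t , ∑t≈1 , y≈) =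
  r , 0≤r , ∑r≈1 , z≈
  where
  r : Vector ℝ _
  r i = mid (s i) (t i)

  0≤r : ∀ i → 0ℝ D.≤ r i
  -- The lower bound obtained is `mid 0ℝ 0ℝ`, whose terms evaluate to `0ℚ`.
  0≤r i = mid-mono-≤ 0ℝ 0ℝ (s i) (t i) (0≤s i) (0≤t i)

  ∑r≈1 : ∑ r D.≈ 1ℝ
  -- The last `refl` is the evaluation of `½ ℚ.* (1ℚ ℚ.+ 1ℚ)` to `1ℚ`.
  ∑r≈1 = ≈-respects-seq (mid (∑ s) (∑ t)) (mid 1ℝ 1ℝ) (∑ r) 1ℝ
    (λ n → sym (seq-∑-mid s t r n (λ _ → refl))) (λ _ → refl)
    (mid-cong (∑ s) (∑ t) 1ℝ 1ℝ ∑s≈1 ∑t≈1)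

  weighted : Vector ℝ _ → ∀ c → Vector ℝ _
  weighted w c i = w i D.* lookup S i c

  z≈ : ∀ c → z c D.≈ ∑ (weighted r c)
  z≈ c = ≈-respects-seq (mid (x c) (y c)) (mid X Y) (z c) (∑ (weighted r c))
    (mid≗z c)
    (λ n → sym (seq-∑-mid (weighted s c) (weighted t c) (weighted r c) n λ i →
      scale-distribʳ ½ (seq (s i) n) (seq (t i) n) (seq (lookup S i c) n)))
    (mid-cong (x c) (y c) X Y (x≈ c) (y≈ c))
    where
    X Y : ℝ
    X = ∑ (weighted s c)
    Y = ∑ (weighted t c)

-- Normalisation in `ℚ./` does not compute on variable numerators. Unnormalised fractions are never
-- reduced, so there the claim is a cross-multiplication with all denominators `1`.
/1-homo-+ : ∀ a b → (a ℤ.+ b) ℚ./ 1 ≡ a ℚ./ 1 ℚ.+ b ℚ./ 1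
/1-homo-+ a b = ℚ.toℚᵘ-injective (begin
  ℚ.toℚᵘ ((a ℤ.+ b) ℚ./ 1)
    ≈⟨ ℚ.toℚᵘ-fromℚᵘ (mkℚᵘ (a ℤ.+ b) 0) ⟩
  mkℚᵘ (a ℤ.+ b) 0
    ≈⟨ *≡* (cong (ℤ._* + 1) (sym (cong₂ ℤ._+_ (ℤ.*-identityʳ a) (ℤ.*-identityʳ b)))) ⟩
  mkℚᵘ a 0 ℚᵘ.+ mkℚᵘ b 0
    ≈⟨ ℚᵘ.+-cong (ℚ.toℚᵘ-fromℚᵘ (mkℚᵘ a 0)) (ℚ.toℚᵘ-fromℚᵘ (mkℚᵘ b 0)) ⟨
  ℚ.toℚᵘ (a ℚ./ 1) ℚᵘ.+ ℚ.toℚᵘ (b ℚ./ 1)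
    ≈⟨ ℚ.toℚᵘ-homo-+ (a ℚ./ 1) (b ℚ./ 1) ⟨
  ℚ.toℚᵘ (a ℚ./ 1 ℚ.+ b ℚ./ 1) ∎)
  where
  open ℚᵘ.≃-Reasoning

½*[a+b]≡m : ∀ a b m → a ℤ.+ b ≡ m ℤ.+ m → ½ ℚ.* (a ℚ./ 1 ℚ.+ b ℚ./ 1) ≡ m ℚ./ 1
½*[a+b]≡m a b m a+b≡m+m = begin
  ½ ℚ.* (a ℚ./ 1 ℚ.+ b ℚ./ 1)             ≡⟨ cong (½ ℚ.*_) (/1-homo-+ a b) ⟨
  ½ ℚ.* ((a ℤ.+ b) ℚ./ 1)                 ≡⟨ cong (λ s → ½ ℚ.* (s ℚ./ 1)) a+b≡m+m ⟩
  ½ ℚ.* ((m ℤ.+ m) ℚ./ 1)                 ≡⟨ cong (½ ℚ.*_) (/1-homo-+ m m) ⟩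
  ½ ℚ.* (m ℚ./ 1 ℚ.+ m ℚ./ 1)             ≡⟨ ℚ.*-distribˡ-+ ½ (m ℚ./ 1) (m ℚ./ 1) ⟩
  ½ ℚ.* (m ℚ./ 1) ℚ.+ ½ ℚ.* (m ℚ./ 1)     ≡⟨ ½-double (m ℚ./ 1) ⟩
  m ℚ./ 1                                 ∎
  where open ≡-Reasoning

-- Writing the midpoint condition as `u ⊕ v ≡ m ⊕ m` avoids division in `ℤ` and is already a
-- coincidence of pair sums.
conv-ι-mid : ∀ {n} (S : List (ℝ^ n)) (u v m : ℤ^ n) → u ⊕ v ≡ m ⊕ m →
  conv S (ι u) → conv S (ι v) → conv S (ι m)
conv-ι-mid S u v m u⊕v≡m⊕m = conv-mid S (ι u) (ι v) (ι m) λ c _ →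
  ½*[a+b]≡m (Vec.lookup u c) (Vec.lookup v c) (Vec.lookup m c) (begin
    Vec.lookup u c ℤ.+ Vec.lookup v c   ≡⟨ lookup-zipWith ℤ._+_ c u v ⟨
    Vec.lookup (u ⊕ v) c                ≡⟨ cong (λ w → Vec.lookup w c) u⊕v≡m⊕m ⟩
    Vec.lookup (m ⊕ m) c                ≡⟨ lookup-zipWith ℤ._+_ c m m ⟩
    Vec.lookup m c ℤ.+ Vec.lookup m c   ∎)
  where open ≡-Reasoning

parity : ℤ → Fin 2
parity a = fromℕ< (n%ℕd<d a 2)

parity≡⇒mid : ∀ a b → parity a ≡ parity b → ∃ λ m → a ℤ.+ b ≡ m ℤ.+ m
-- With common remainder `r`, `a = r + 2q` and `b = r + 2q′`, so half of the sum is `r + q + q′`.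
parity≡⇒mid a b eq = + r ℤ.+ (q ℤ.+ q′) , (begin
  a ℤ.+ b
    ≡⟨ cong₂ ℤ._+_ (a≡a%ℕn+[a/ℕn]*n a 2) (a≡a%ℕn+[a/ℕn]*n b 2) ⟩
  (+ r ℤ.+ q ℤ.* + 2) ℤ.+ (+ (b %ℕ 2) ℤ.+ q′ ℤ.* + 2)
    ≡⟨ cong (λ s → (+ r ℤ.+ q ℤ.* + 2) ℤ.+ (+ s ℤ.+ q′ ℤ.* + 2)) r≡ ⟨
  (+ r ℤ.+ q ℤ.* + 2) ℤ.+ (+ r ℤ.+ q′ ℤ.* + 2)
    ≡⟨ ℤS.solve 3 (λ r q q′ →
         (r ℤS.:+ q ℤS.:* ℤS.con (+ 2)) ℤS.:+ (r ℤS.:+ q′ ℤS.:* ℤS.con (+ 2))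
         ℤS.:= (r ℤS.:+ (q ℤS.:+ q′)) ℤS.:+ (r ℤS.:+ (q ℤS.:+ q′)))
       refl (+ r) q q′ ⟩
  (+ r ℤ.+ (q ℤ.+ q′)) ℤ.+ (+ r ℤ.+ (q ℤ.+ q′)) ∎)
  where
  open ≡-Reasoning
  module ℤS = ℤ.+-*-Solver
  r : ℕ
  r = a %ℕ 2
  q q′ : ℤ
  q  = a /ℕ 2
  q′ = b /ℕ 2
  r≡ : r ≡ b %ℕ 2
  r≡ = fromℕ<-injective _ _ (n%ℕd<d a 2) (n%ℕd<d b 2) eq

parities≡⇒mid : ∀ {n} (u v : ℤ^ n) →
  (∀ c → parity (Vec.lookup u c) ≡ parity (Vec.lookup v c)) →
  ∃ λ m → u ⊕ v ≡ m ⊕ m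
parities≡⇒mid []      []      eq = [] , refl
parities≡⇒mid (a ∷ u) (b ∷ v) eq
  with m , a+b≡m+m ← parity≡⇒mid a b (eq zero)
     | w , u⊕v≡w⊕w ← parities≡⇒mid u v (eq ∘ suc)
  = m ∷ w , cong₂ _∷_ a+b≡m+m u⊕v≡w⊕w

-- The class of `u` modulo 2, coded as one number so that the pigeonhole principle for `Fin`
-- applies; `finToFun` recovers the single parities.
parityClass : ∀ {n} → ℤ^ n → Fin (2 ^ n)
parityClass u = funToFin (parity ∘ Vec.lookup u)

parityClass≡⇒mid : ∀ {n} (u v : ℤ^ n) → parityClass u ≡ parityClass v →
  ∃ λ m → u ⊕ v ≡ m ⊕ m
parityClass≡⇒mid u v eq = parities≡⇒mid u v λ c → begin
  parity (Vec.lookup u c)      ≡⟨ finToFun-funToFin (parity ∘ Vec.lookup u) c ⟨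
  finToFun (parityClass u) c   ≡⟨ cong (λ k → finToFun k c) eq ⟩
  finToFun (parityClass v) c   ≡⟨ finToFun-funToFin (parity ∘ Vec.lookup v) c ⟩
  parity (Vec.lookup v c)      ∎
  where open ≡-Reasoning

∈-pair⇒≡ : ∀ {A : Set} {x y : A} → x ∈ y ∷ y ∷ [] → x ≡ y
∈-pair⇒≡ (here x≡y)         = x≡y
∈-pair⇒≡ (there (here x≡y)) = x≡y

-- Permutations preserve membership, so `x` and `y` both lie in a list whose only value is `z`.
↭-constant⇒≡ : ∀ {A : Set} {x y z : A} → (x ∷ y ∷ []) ↭ (z ∷ z ∷ []) → x ≡ y
↭-constant⇒≡ p = trans (∈-pair⇒≡ (∈-resp-↭ p (here refl)))
  (sym (∈-pair⇒≡ (∈-resp-↭ p (there (here refl)))))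

parityClass-injective : ∀ {n} {P : Pred (ℝ^ n) 0ℓ} → IsDPSPolytope P →
  ∀ {u v} → 𝓛 P u → 𝓛 P v → parityClass u ≡ parityClass v → u ≡ v
parityClass-injective {P = P} dps {u} {v} u∈P v∈P eq
  with S , P⊆conv , conv⊆P ← IsDPSPolytope.isLatticePolytope dps
     | m , u⊕v≡m⊕m ← parityClass≡⇒mid u v eq
  = ↭-constant⇒≡ (IsDPSPolytope.distinctPairSums dps u v m m u∈P v∈P m∈P m∈P u⊕v≡m⊕m)
  where
  m∈P : 𝓛 P m
  -- `P` agrees with a convex hull only up to `≐`, so membership passes to `conv` and back.
  m∈P = conv⊆P (conv-ι-mid (map ι S) u v m u⊕v≡m⊕m (P⊆conv u∈P) (P⊆conv v∈P))

theorem2 : (n : ℕ) → 1 ≤ n → (P : Pred (ℝ^ n) 0ℓ) → IsDPSPolytope P →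
    (N : ℕ) → HasCardinality (𝓛 P) N → N ≤ 2 ^ n
theorem2 n _ P dps N card = ≮⇒≥ λ 2^n<N →
  let i , j , i<j , eq = pigeonhole 2^n<N (parityClass ∘ proj₁ ∘ to)
  -- Equality in `subsetSetoid` ignores membership proofs, so equality of the two points is enough
  -- for `injective` to yield `i ≡ j`.
  in <⇒≢ i<j (injective (parityClass-injective dps (proj₂ (to i)) (proj₂ (to j)) eq))
  where open Bijection card using (to; injective)
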